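{- Let $k\geq 3$. There exist a constant $C'=C'(k)$ and an infinite sequence of positive integers $\{n_i\}_{i=1}^\infty$ such that for every $n\in\{n_i\}_{i=1}^\infty$ and every set $A\subseteq[n]^k$ with $|A| = C'\cdot c_k(n)$, we have $$\Gamma_k(A)\ \geq\ \log^{3k+1} n\cdot\left(\frac{n^k}{c_k(n)}\right)^{k}\cdot n^{k-1} \;=\; \Upsilon(n)\cdot n^k,$$ where $\Upsilon(n)=\frac{\log^{3k+1} n}{n}\left(\frac{n^k}{c_k(n)}\right)^k$.
   Context: $[n]=\{1,\dots,n\}$. A $k$-dimensional corner in $[n]^k$ is a set of the form $\{\mathbf{a}\}\cup\{\mathbf{a}+de_i:1\le i\le k\}\subseteq[n]^k$ with $\mathbf{a}\in[n]^k$, $d>0$ an integer, and $e_1,\dots,e_k$ the standard basis vectors. $c_k(n)$ is the maximum size of a subset of $[n]^k$ containing no $k$-dimensional corner. $\Gamma_k(A)$ denotes the number of $k$-dimensional corners contained in $A$. Logarithms are base $2$. -}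

module Defs where

open import Data.Nat using (ℕ; zero; suc; _+_; _≤_; _<?_)
open import Data.Bool using (Bool; true; false; _∧_; if_then_else_)
open import Data.Fin using (Fin; toℕ; fromℕ<)
open import Data.Vec using (Vec; []; _∷_; lookup; _[_]≔_)
open import Data.List using (List; []; _∷_; [_]; map; concatMap; allFin; applyUpTo)
open import Data.Bool.ListAction using (and)
open import Data.Nat.ListAction using (sum)
open import Data.Maybe using (Maybe; just; nothing)
open import Relation.Nullary using (yes; no)
open import Relation.Binary.PropositionalEquality using (_≡_)

-- A point of [n]^k, encoded 0-indexed: coordinate j ∈ Fin n stands for j+1 ∈ [n].
Point : ℕ → ℕ → Set
Point k n = Vec (Fin n) k

allPoints : ∀ k n → List (Point k n)
allPoints zero    n = [ [] ]
allPoints (suc k) n = concatMap (λ x → map (x ∷_) (allPoints k n)) (allFin n)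

shift : ∀ {k n} → Point k n → Fin k → ℕ → Maybe (Point k n)
shift {k} {n} a i d with toℕ (lookup a i) + d <? n
... | yes p = just (a [ i ]≔ fromℕ< p)
... | no _  = nothing

Subset : ℕ → ℕ → Set
Subset k n = Point k n → Bool

memb : ∀ {k n} → Subset k n → Maybe (Point k n) → Bool
memb A (just p) = A p
memb A nothing  = false

cornerIn : ∀ {k n} → Subset k n → Point k n → ℕ → Bool
cornerIn {k} A a d = A a ∧ and (map (λ i → memb A (shift a i d)) (allFin k))

count : ∀ {X : Set} → (X → Bool) → List X → ℕ
count p xs = sum (map (λ x → if p x then 1 else 0) xs)

size : ∀ {k n} → Subset k n → ℕ
size {k} {n} A = count A (allPoints k n)

-- Γ_k(A): number of corners (a, d) with d ≥ 1 contained in A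
-- (a corner with d ≥ n cannot lie in [n]^k, so d ranges over 1..n)
Γ : ∀ {k n} → Subset k n → ℕ
Γ {k} {n} A = sum (map (λ a → count (λ d → cornerIn A a d) (applyUpTo suc n)) (allPoints k n))

CornerFree : ∀ {k n} → Subset k n → Set
CornerFree {k} {n} A = ∀ (a : Point k n) (d : ℕ) → 1 ≤ d → cornerIn A a d ≡ false

IsCk : ℕ → ℕ → ℕ → Set
IsCk k n c = (Data.Product.Σ (Subset k n) λ A → CornerFree A Data.Product.× size A ≡ c)
             Data.Product.× (∀ (A : Subset k n) → CornerFree A → size A ≤ c)
  where import Data.Product

{-# OPTIONS --safe #-}
-- Deleting from A every base point of a corner in A leaves a corner-free set, so
-- Γ(A) ≥ |A| − c_k(n), which is at least c_k(n) when |A| = 2 c_k(n). The claim then follows from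
-- c_k(n)^{k+1} ≥ log^{3k+1} n · n^{k²+k−1}, that is, from c_k(n) ≥ n^k / 2^{O(√(log n))}. For this
-- take the points (y + s, y, …) with s in a Behrend-type progression-free set: s has digits z ∈ [m]^r
-- in base 2m and leading digit |z|², so that s + s″ = 2 s′ holds digit by digit (there are no carries)
-- and strict convexity of |z|² forces z = z″. With m = 2^r and n = 2^{r² + 4r + 1} this
-- gives n^k / c_k(n) ≤ 2^{4r + 2}, and every r ≥ 10k + 6 suffices.
module Submission where

open import Defs
open import Data.Nat using (ℕ; _+_; _*_; _∸_; _^_; _≤_)
open import Data.Product using (Σ; _×_)
open import Relation.Binary.PropositionalEquality using (_≡_)

open import Data.Bool using (Bool; true; false; T; T?; _∧_; if_then_else_)
open import Data.Bool.Properties using (T-≡; T-∧; ¬-not)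
open import Data.Fin using (Fin; zero; suc; toℕ; fromℕ<; inject≤)
open import Data.Fin.Properties
  using (toℕ-injective; toℕ-fromℕ<; toℕ-inject≤; toℕ<n; injective⇒≤)
import Data.Fin.Properties as Fin
open import Data.List
  using (List; []; _∷_; _++_; map; length; lookup; filter; concatMap; allFin; applyUpTo; cartesianProductWith)
open import Data.List.Properties using (length-map; length-++; length-tabulate)
open import Data.List.Membership.Propositional using (_∈_)
open import Data.List.Membership.Propositional.Properties
  using (∈-lookup; ∈-filter⁺; ∈-allFin; ∈-applyUpTo⁺; ∈-cartesianProductWith⁺; ∈-cartesianProductWith⁻)
open import Data.List.Relation.Binary.Subset.Propositional using (_⊆_)
import Data.List.Relation.Unary.All as All
import Data.List.Relation.Unary.All.Properties as All
open import Data.List.Relation.Unary.AllPairs using ([]; _∷_)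
open import Data.List.Relation.Unary.Any using (here; there; index)
open import Data.List.Relation.Unary.Any.Properties using (lookup-index)
open import Data.List.Relation.Unary.Unique.Propositional using (Unique)
import Data.List.Relation.Unary.Unique.Propositional.Properties as Unique
open import Data.Maybe using (just)
open import Data.Nat using (zero; suc; _<_; _<?_; _≡ᵇ_; NonZero; z≤n; s≤s)
open import Data.Nat.DivMod using (_%_; [m+kn]%n≡m%n; m<n⇒m%n≡m)
open import Data.Nat.ListAction using (sum)
open import Data.Nat.Properties
open import Data.Nat.Tactic.RingSolver using (solve-∀)
open import Data.Product using (_,_; proj₁; proj₂; ∃)
open import Data.Sum using (inj₁; inj₂)
open import Data.Vec as Vec using ([]; _∷_; _[_]≔_)
import Data.Vec.Properties as Vec
open import Function using (_∘_; id)
open import Function.Bundles using (Equivalence)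
open import Relation.Binary.PropositionalEquality
  using (refl; sym; trans; cong; cong₂; subst; subst₂)
open import Relation.Nullary using (yes; no; contradiction)
open import Relation.Nullary.Decidable using (⌊_⌋; toWitness; fromWitness)

private
  variable
    X Y Z : Set
    j k n m r h c : ℕ

T⇒≡ : ∀ {b} → T b → b ≡ true
T⇒≡ = Equivalence.to T-≡

≡⇒T : ∀ {b} → b ≡ true → T b
≡⇒T = Equivalence.from T-≡

interchange : ∀ a b c d → (a + b) + (c + d) ≡ (a + c) + (b + d)
interchange = solve-∀

-- Counting

lookup-injective : ∀ {xs : List X} → Unique xs → ∀ {i j} → lookup xs i ≡ lookup xs j → i ≡ j
lookup-injective (_ ∷ _)  {zero}  {zero}  _  = refl
lookup-injective (x∉ ∷ _) {zero}  {suc j} eq = contradiction eq (All.lookup x∉ (∈-lookup j))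
lookup-injective (x∉ ∷ _) {suc i} {zero}  eq = contradiction (sym eq) (All.lookup x∉ (∈-lookup i))
lookup-injective (_ ∷ u)  {suc i} {suc j} eq = cong suc (lookup-injective u eq)

-- Sending each position in `xs` to a position of the same entry in `ys` is injective, because `xs`
-- has no repetitions.
Unique-⊆⇒length≤ : ∀ {xs ys : List X} → Unique xs → xs ⊆ ys → length xs ≤ length ys
Unique-⊆⇒length≤ {xs = xs} {ys} u xs⊆ys = injective⇒≤ {f = f} λ {i} {j} eq →
  lookup-injective u (trans (lookup-index (mem i))
    (trans (cong (lookup ys) eq) (sym (lookup-index (mem j)))))
  where
  mem : ∀ i → lookup xs i ∈ ys
  mem i = xs⊆ys (∈-lookup i)
  f : Fin (length xs) → Fin (length ys)
  f i = index (mem i)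

length-filter≡count : ∀ (p : X → Bool) xs → length (filter (T? ∘ p) xs) ≡ count p xs
length-filter≡count p []       = refl
length-filter≡count p (x ∷ xs) with p x
... | true  = cong suc (length-filter≡count p xs)
... | false = length-filter≡count p xs

∈⇒count≥1 : ∀ (p : X → Bool) {x xs} → x ∈ xs → p x ≡ true → 1 ≤ count p xs
∈⇒count≥1 p (here refl) px rewrite px = s≤s z≤n
∈⇒count≥1 p (there x∈)  px = m≤n⇒m≤o+n _ (∈⇒count≥1 p x∈ px)

-- Lets the results on cartesian products of lists apply to `allPoints`.
concatMap-map≡cartesianProductWith : ∀ (f : X → Y → Z) xs ys →
  concatMap (λ x → map (f x) ys) xs ≡ cartesianProductWith f xs ys
concatMap-map≡cartesianProductWith f []       ys = refl
concatMap-map≡cartesianProductWith f (x ∷ xs) ys =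
  cong (map (f x) ys ++_) (concatMap-map≡cartesianProductWith f xs ys)

length-cartesianProductWith : ∀ (f : X → Y → Z) xs ys →
  length (cartesianProductWith f xs ys) ≡ length xs * length ys
length-cartesianProductWith f []       ys = refl
length-cartesianProductWith f (x ∷ xs) ys =
  trans (length-++ (map (f x) ys))
    (cong₂ _+_ (length-map (f x) ys) (length-cartesianProductWith f xs ys))

length-allFin : ∀ n → length (allFin n) ≡ n
length-allFin n = length-tabulate {n = n} id

allPoints-suc : ∀ k n →
  allPoints (suc k) n ≡ cartesianProductWith _∷_ (allFin n) (allPoints k n)
allPoints-suc k n = concatMap-map≡cartesianProductWith _∷_ (allFin n) (allPoints k n)

∈-allPoints : (p : Point k n) → p ∈ allPoints k n
∈-allPoints []                        = here refl
∈-allPoints {suc k} {n} (x ∷ p) rewrite allPoints-suc k n =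
  ∈-cartesianProductWith⁺ _∷_ (∈-allFin x) (∈-allPoints p)

allPoints-unique : ∀ k n → Unique (allPoints k n)
allPoints-unique zero    n = All.[] ∷ []
allPoints-unique (suc k) n rewrite allPoints-suc k n =
  Unique.cartesianProductWith⁺ _∷_ Vec.∷-injective (Unique.allFin⁺ n) (allPoints-unique k n)

length-allPoints : ∀ k n → length (allPoints k n) ≡ n ^ k
length-allPoints zero    n = refl
length-allPoints (suc k) n rewrite allPoints-suc k n =
  trans (length-cartesianProductWith _∷_ (allFin n) (allPoints k n))
    (cong₂ _*_ (length-allFin n) (length-allPoints k n))

length≤size : ∀ (A : Subset k n) {ps} → Unique ps → (∀ {p} → p ∈ ps → T (A p)) →
  length ps ≤ size A
length≤size {k} {n} A u ps⊆A =
  subst (_ ≤_) (length-filter≡count A (allPoints k n))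
    (Unique-⊆⇒length≤ u λ p∈ → ∈-filter⁺ (T? ∘ A) (∈-allPoints _) (ps⊆A p∈))

-- Corners

T-memb-shift : ∀ (A : Subset k n) a i d → T (memb A (shift a i d)) →
  ∃ λ (p : toℕ (Vec.lookup a i) + d < n) → T (A (a [ i ]≔ fromℕ< p))
T-memb-shift {n = n} A a i d t with toℕ (Vec.lookup a i) + d <? n
... | yes p = p , t

T-cornerIn⁻ : ∀ (A : Subset k n) a d → T (cornerIn A a d) →
  T (A a) × (∀ i → T (memb A (shift a i d)))
T-cornerIn⁻ {k} A a d t =
  let ta , ts = Equivalence.to T-∧ t
  in ta , λ i → All.lookup (All.all⁺ (λ i → memb A (shift a i d)) (allFin k) ts) (∈-allFin i)

T-cornerIn⁺ : ∀ (A : Subset k n) a d → T (A a) → (∀ i → T (memb A (shift a i d))) →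
  T (cornerIn A a d)
T-cornerIn⁺ {k} A a d ta ts = Equivalence.from T-∧
  (ta , All.all⁻ (λ i → memb A (shift a i d)) (All.tabulate {xs = allFin k} λ {i} _ → ts i))

memb-mono : ∀ {A B : Subset k n} → (∀ p → T (B p) → T (A p)) → ∀ q → T (memb B q) → T (memb A q)
memb-mono B⊆A (just p) = B⊆A p

cornerIn-mono : ∀ {A B : Subset k n} → (∀ p → T (B p) → T (A p)) →
  ∀ a d → T (cornerIn B a d) → T (cornerIn A a d)
cornerIn-mono {A = A} {B} B⊆A a d t =
  let tb , ts = T-cornerIn⁻ B a d t
  in T-cornerIn⁺ A a d (B⊆A a tb) λ i → memb-mono {A = A} {B} B⊆A (shift a i d) (ts i)

-- Deleting the base points of corners

cornersAt : Subset k n → Point k n → ℕ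
cornersAt {n = n} A a = count (λ d → cornerIn A a d) (applyUpTo suc n)

withoutBases : Subset k n → Subset k n
withoutBases A a = A a ∧ (cornersAt A a ≡ᵇ 0)

withoutBases-⊆ : ∀ (A : Subset k n) p → T (withoutBases A p) → T (A p)
withoutBases-⊆ A p t = proj₁ (Equivalence.to T-∧ t)

-- A corner of the thinned set is a corner of `A` with the same base, and that base was deleted.
-- Positive dimension supplies a shift that bounds the step.
withoutBases-cornerFree : ∀ (A : Subset (suc k) n) → CornerFree (withoutBases A)
withoutBases-cornerFree {n = n} A a (suc d) 1≤d = ¬-not λ eq →
  let B       = withoutBases A
      tb , ts = T-cornerIn⁻ B a (suc d) (≡⇒T eq)
      a₀+d<n  = proj₁ (T-memb-shift B a zero (suc d) (ts zero))
      -- The step `suc d` must be one of 1, ..., n to be counted by `cornersAt`.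
      d<n     = <-trans (n<1+n d) (≤-<-trans (m≤n+m (suc d) _) a₀+d<n)
      none    = ≡ᵇ⇒≡ (cornersAt A a) 0 (proj₂ (Equivalence.to T-∧ tb))
      one     = ∈⇒count≥1 (λ d → cornerIn A a d) (∈-applyUpTo⁺ suc d<n)
                  (T⇒≡ (cornerIn-mono {A = A} {B} (withoutBases-⊆ A) a (suc d) (≡⇒T eq)))
  in contradiction (subst (1 ≤_) none one) λ ()

-- Pointwise, a survivor pays for itself, and a deleted point is the base of at least one corner.
count-withoutBases : ∀ (A : Subset k n) ps →
  count A ps ≤ count (withoutBases A) ps + sum (map (cornersAt A) ps)
count-withoutBases A []       = z≤n
count-withoutBases A (p ∷ ps) = begin
  χ (A p) + count A ps                                         ≤⟨ +-mono-≤ (head (A p) (cornersAt A p)) (count-withoutBases A ps) ⟩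
  (χ (B p) + g) + (count B ps + sum (map (cornersAt A) ps))    ≡⟨ interchange (χ (B p)) g (count B ps) _ ⟩
  (χ (B p) + count B ps) + (g + sum (map (cornersAt A) ps))    ∎
  where
  open ≤-Reasoning
  B = withoutBases A
  g = cornersAt A p
  χ : Bool → ℕ
  χ b = if b then 1 else 0
  head : ∀ b g → χ b ≤ χ (b ∧ (g ≡ᵇ 0)) + g
  head false g       = z≤n
  head true  zero    = s≤s z≤n
  head true  (suc g) = s≤s z≤n

-- At most `c` points survive, and `cornersAt` summed over the grid is `Γ A` by definition.
size≤c+Γ : IsCk (suc k) n c → (A : Subset (suc k) n) → size A ≤ c + Γ A
size≤c+Γ {k} {n} (_ , max) A = ≤-trans (count-withoutBases A (allPoints (suc k) n))
  (+-monoˡ-≤ (Γ A) (max (withoutBases A) (withoutBases-cornerFree A)))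

-- The progression-free set

-- Digits in base `B`, least significant first; `w` is the leading digit and may exceed `B`.
encode : ℕ → Point r m → ℕ → ℕ
encode B []       w = w
encode B (z ∷ zs) w = toℕ z + B * encode B zs w

sumSq : Point r m → ℕ
sumSq []       = 0
sumSq (z ∷ zs) = toℕ z * toℕ z + sumSq zs

divMod-unique : ∀ {B u u′ v v′} .{{_ : NonZero B}} → u < B → u′ < B →
  u + B * v ≡ u′ + B * v′ → u ≡ u′ × v ≡ v′
divMod-unique {B} {u} {u′} {v} {v′} u<B u′<B eq =
  u≡u′ , *-cancelˡ-≡ v v′ B (+-cancelˡ-≡ u _ _ (trans eq (cong (_+ B * v′) (sym u≡u′))))
  where
  rem : ∀ {u} v → u < B → (u + B * v) % B ≡ u
  rem {u} v u<B = trans (cong (λ x → (u + x) % B) (*-comm B v))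
    (trans ([m+kn]%n≡m%n u v B) (m<n⇒m%n≡m u<B))
  u≡u′ = trans (sym (rem v u<B)) (trans (cong (_% B) eq) (rem v′ u′<B))

infix 4 _⊕_≐_⊕_
data _⊕_≐_⊕_ {m} : Point r m → Point r m → Point r m → Point r m → Set where
  []  : [] ⊕ [] ≐ [] ⊕ []
  _∷_ : ∀ {u v u′ v′} {us vs us′ vs′ : Point r m} →
        toℕ u + toℕ v ≡ toℕ u′ + toℕ v′ → us ⊕ vs ≐ us′ ⊕ vs′ →
        (u ∷ us) ⊕ (v ∷ vs) ≐ (u′ ∷ us′) ⊕ (v′ ∷ vs′)

-- Two digits below m add up to less than the base m + m, so there are no carries and the digit sums
-- can be peeled off one by one.
encode-sum : ∀ (a b a′ b′ : Point r m) {w x w′ x′} →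
  encode (m + m) a w + encode (m + m) b x ≡ encode (m + m) a′ w′ + encode (m + m) b′ x′ →
  a ⊕ b ≐ a′ ⊕ b′ × w + x ≡ w′ + x′
encode-sum [] [] [] [] eq = [] , eq
-- The pattern `suc _` makes the base nonzero, as `divMod-unique` requires.
encode-sum {m = m@(suc _)} (a ∷ as) (b ∷ bs) (a′ ∷ as′) (b′ ∷ bs′) {w} {x} {w′} {x′} eq =
  let a+b , eqs = divMod-unique (+-mono-< (toℕ<n a) (toℕ<n b)) (+-mono-< (toℕ<n a′) (toℕ<n b′))
                    (trans (sym (regroup (toℕ a) (toℕ b) (m + m) (encode (m + m) as w) (encode (m + m) bs x)))
                      (trans eq (regroup (toℕ a′) (toℕ b′) (m + m) (encode (m + m) as′ w′) (encode (m + m) bs′ x′))))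
      as+bs , w+x = encode-sum as bs as′ bs′ eqs
  in a+b ∷ as+bs , w+x
  where
  regroup : ∀ a b B p q → (a + B * p) + (b + B * q) ≡ (a + b) + B * (p + q)
  regroup = solve-∀

double-injective : ∀ {a b} → a + a ≡ b + b → a ≡ b
double-injective {a} {b} eq = *-cancelˡ-≡ a b 2
  (subst₂ (λ x y → a + x ≡ b + y) (sym (+-identityʳ a)) (sym (+-identityʳ b)) eq)

≐-double-injective : ∀ {a b : Point r m} → a ⊕ a ≐ b ⊕ b → a ≡ b
≐-double-injective []         = refl
≐-double-injective (eq ∷ eqs) =
  cong₂ _∷_ (toℕ-injective (double-injective eq)) (≐-double-injective eqs)

-- Here f = |b − a|.
square-defect : ∀ a b c → a + c ≡ b + b →
  ∃ λ f → a * a + c * c ≡ b * b + b * b + (f * f + f * f) × (f ≡ 0 → a ≡ b)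
square-defect a b c eq with ≤-total a b
... | inj₁ a≤b with m≤n⇒∃[o]m+o≡n a≤b
...   | f , refl = f , trans (cong (λ c → a * a + c * c) c≡) (id₁ a f) , λ { refl → sym (+-identityʳ a) }
  where
  c≡ : c ≡ a + f + f
  c≡ = +-cancelˡ-≡ a _ _ (trans eq (id₀ a f))
    where
    id₀ : ∀ a f → (a + f) + (a + f) ≡ a + (a + f + f)
    id₀ = solve-∀
  id₁ : ∀ a f → a * a + (a + f + f) * (a + f + f) ≡
                (a + f) * (a + f) + (a + f) * (a + f) + (f * f + f * f)
  id₁ = solve-∀
square-defect a b c eq | inj₂ b≤a with m≤n⇒∃[o]m+o≡n b≤a
...   | f , refl = f , trans (cong (λ b → (b + f) * (b + f) + c * c) b≡)
                         (trans (id₁ c f) (cong (λ b → b * b + b * b + (f * f + f * f)) (sym b≡)))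
                     , λ { refl → +-identityʳ b }
  where
  b≡ : b ≡ c + f
  b≡ = +-cancelˡ-≡ b _ _ (trans (sym eq) (id₀ b f c))
    where
    id₀ : ∀ b f c → b + f + c ≡ b + (c + f)
    id₀ = solve-∀
  id₁ : ∀ c f → (c + f + f) * (c + f + f) + c * c ≡
                (c + f) * (c + f) + (c + f) * (c + f) + (f * f + f * f)
  id₁ = solve-∀

-- Strict convexity of |z|²: the excess `e` is built as 2|a - b|², coordinate by coordinate, so it
-- vanishes only if every difference does.
sumSq-defect : ∀ {a c b : Point r m} → a ⊕ c ≐ b ⊕ b →
  ∃ λ e → sumSq a + sumSq c ≡ sumSq b + sumSq b + e × (e ≡ 0 → a ≡ b)
sumSq-defect [] = 0 , refl , λ _ → refl
sumSq-defect (_∷_ {u = a} {v = c} {u′ = b} {us = as} {cs} {bs} eq eqs) =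
  let f , sq , a≡b   = square-defect (toℕ a) (toℕ b) (toℕ c) eq
      e , sqs , as≡bs = sumSq-defect eqs
      A = toℕ a * toℕ a ; B = toℕ b * toℕ b ; C = toℕ c * toℕ c
  in f * f + f * f + e
   , trans (interchange A (sumSq as) C (sumSq cs))
       (trans (cong₂ _+_ sq sqs) (regroup B (f * f) (sumSq bs) e))
   , λ z → cong₂ _∷_
       (toℕ-injective (a≡b (square≡0 f (m+n≡0⇒m≡0 (f * f) (m+n≡0⇒m≡0 (f * f + f * f) z)))))
       (as≡bs (m+n≡0⇒n≡0 (f * f + f * f) z))
  where
  regroup : ∀ b f s e → (b + b + (f + f)) + (s + s + e) ≡ (b + s) + (b + s) + (f + f + e)
  regroup = solve-∀
  square≡0 : ∀ f → f * f ≡ 0 → f ≡ 0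
  square≡0 zero _ = refl

-- The point (z, |z|²) of a paraboloid, read as one number. Behrend's construction restricts z to a
-- sphere; storing the norm as leading digit keeps all m^r vectors.
paraboloid : Point r m → ℕ
paraboloid {m = m} z = encode (m + m) z (sumSq z)

-- Adding the equation to itself gives it the shape that `encode-sum` handles.
paraboloid-injective : ∀ {a b : Point r m} → paraboloid a ≡ paraboloid b → a ≡ b
paraboloid-injective {a = a} {b} eq =
  ≐-double-injective (proj₁ (encode-sum a a b b (cong₂ _+_ eq eq)))

-- The low digits make `b` the midpoint of `a` and `c`; the leading digits then say that the
-- convexity excess is zero.
paraboloid-progressionFree : ∀ {a b c : Point r m} →
  paraboloid a + paraboloid c ≡ paraboloid b + paraboloid b → a ≡ b
paraboloid-progressionFree {a = a} {b} {c} eq =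
  let digits , tops  = encode-sum a c b b eq
      e , defect , z = sumSq-defect digits
  in z (+-cancelˡ-≡ (sumSq b + sumSq b) e 0
        (trans (sym defect) (trans tops (sym (+-identityʳ _)))))

sumSq≤ : ∀ (z : Point r m) → sumSq z ≤ r * (m * m)
sumSq≤ []       = z≤n
sumSq≤ (z ∷ zs) = +-mono-≤ (*-mono-≤ (<⇒≤ (toℕ<n z)) (<⇒≤ (toℕ<n z))) (sumSq≤ zs)

encode< : ∀ (z : Point r m) w → encode (m + m) z w < (m + m) ^ r * suc w
encode< []       w = ≤-reflexive (sym (+-identityʳ (suc w)))
encode< {suc r} {m} (z ∷ zs) w = begin-strict
  toℕ z + B * e        <⟨ +-monoˡ-< (B * e) (<-≤-trans (toℕ<n z) (m≤m+n m m)) ⟩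
  B + B * e            ≡⟨ *-suc B e ⟨
  B * suc e            ≤⟨ *-monoʳ-≤ B (encode< zs w) ⟩
  B * (B ^ r * suc w)  ≡⟨ *-assoc B (B ^ r) (suc w) ⟨
  B * B ^ r * suc w    ∎
  where
  open ≤-Reasoning
  B = m + m
  e = encode B zs w

paraboloid< : ∀ (z : Point r m) → paraboloid z < (m + m) ^ r * suc (r * (m * m))
paraboloid< {r} {m} z =
  <-≤-trans (encode< z (sumSq z)) (*-monoʳ-≤ ((m + m) ^ r) (s≤s (sumSq≤ z)))

-- The corner-free set over the progression-free set

-- A corner (x, y), (x + d, y), (x, y + d) projects under x − y to the progression
-- t, t + d, t − d, so a progression-free set of differences gives a corner-free set.
module CornerFreeSet {r m h n} (j : ℕ)
  (bound : (m + m) ^ r * suc (r * (m * m)) ≤ h) (2h≤n : h + h ≤ n) where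

  h≤n : h ≤ n
  h≤n = ≤-trans (m≤m+n h h) 2h≤n

  sum<n : ∀ (y : Fin h) (z : Point r m) → toℕ y + paraboloid z < n
  sum<n y z = <-≤-trans (+-mono-< (toℕ<n y) (<-≤-trans (paraboloid< z) bound)) 2h≤n

  -- The tail is free, since the first two directions already rule out corners.
  point : Fin h → Point r m × Point j n → Point (suc (suc j)) n
  point y (z , p) = fromℕ< (sum<n y z) ∷ inject≤ y h≤n ∷ p

  point-coords : ∀ {x₁ x₂ p y zq} → (x₁ ∷ x₂ ∷ p) ≡ point y zq →
    toℕ x₁ ≡ toℕ x₂ + paraboloid (proj₁ zq)
  point-coords {y = y} {z , _} refl =
    trans (toℕ-fromℕ< (sum<n y z)) (cong (_+ paraboloid z) (sym (toℕ-inject≤ y h≤n)))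

  point-injective : ∀ {y y′ zp zp′} → point y zp ≡ point y′ zp′ → y ≡ y′ × zp ≡ zp′
  point-injective {y} {y′} {z , p} {z′ , p′} eq
    with eq₁ , eq′ ← Vec.∷-injective eq
    with eq₂ , refl ← Vec.∷-injective eq′
    with refl ← Fin.inject≤-injective h≤n h≤n y y′ eq₂
    with refl ← paraboloid-injective {a = z} {z′} (+-cancelˡ-≡ (toℕ y) _ _
      (trans (sym (toℕ-fromℕ< (sum<n y z))) (trans (cong toℕ eq₁) (toℕ-fromℕ< (sum<n y z′)))))
    = refl , refl

  params : List (Point r m × Point j n)
  params = cartesianProductWith _,_ (allPoints r m) (allPoints j n)

  points : List (Point (suc (suc j)) n)
  points = cartesianProductWith point (allFin h) params

  points-unique : Unique points
  points-unique = Unique.cartesianProductWith⁺ point point-injective (Unique.allFin⁺ h)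
    (Unique.cartesianProduct⁺ (allPoints-unique r m) (allPoints-unique j n))

  length-points : length points ≡ h * (m ^ r * n ^ j)
  length-points = trans (length-cartesianProductWith point (allFin h) params)
    (cong₂ _*_ (length-allFin h)
      (trans (length-cartesianProductWith _,_ (allPoints r m) (allPoints j n))
        (cong₂ _*_ (length-allPoints r m) (length-allPoints j n))))

  open import Data.List.Membership.DecPropositional
    (Vec.≡-dec {A = Fin n} {n = suc (suc j)} Fin._≟_) using (_∈?_)

  S : Subset (suc (suc j)) n
  S p = ⌊ p ∈? points ⌋

  S-coords : ∀ {x y p} → T (S (x ∷ y ∷ p)) → ∃ λ z → toℕ x ≡ toℕ y + paraboloid {r} {m} z
  S-coords {x} {y} {p} t with ∈-cartesianProductWith⁻ point (allFin h) params
                                (toWitness {a? = (x ∷ y ∷ p) ∈? points} t)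
  ... | y′ , (z , q) , _ , _ , eq = z , point-coords {y = y′} {z , q} eq

  S-cornerFree : CornerFree S
  S-cornerFree (x ∷ y ∷ p) (suc d) _ = ¬-not λ eq →
    let t , ts    = T-cornerIn⁻ S (x ∷ y ∷ p) (suc d) (≡⇒T eq)
        x+d< , t₁ = T-memb-shift S (x ∷ y ∷ p) zero (suc d) (ts zero)
        y+d< , t₂ = T-memb-shift S (x ∷ y ∷ p) (suc zero) (suc d) (ts (suc zero))
        z₀ , e₀   = S-coords t
        z₁ , e₁   = S-coords t₁
        z₂ , e₂   = S-coords t₂
        -- Moving the first coordinate raises the difference x - y by `suc d` (`s₁`); moving the
        -- second lowers it by as much (`s₂`).
        s₁ : paraboloid z₀ + suc d ≡ paraboloid z₁
        s₁ = +-cancelˡ-≡ (toℕ y) _ _ (trans (sym (+-assoc (toℕ y) _ _))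
               (trans (cong (_+ suc d) (sym e₀)) (trans (sym (toℕ-fromℕ< x+d<)) e₁)))
        s₂ : paraboloid z₀ ≡ suc d + paraboloid z₂
        s₂ = +-cancelˡ-≡ (toℕ y) _ _ (trans (sym e₀) (trans e₂
               (trans (cong (_+ paraboloid z₂) (toℕ-fromℕ< y+d<)) (+-assoc (toℕ y) _ _))))
        -- The base point carries the middle term of the progression.
        z₁≡z₀ = paraboloid-progressionFree {a = z₁} {z₀} {z₂}
          (trans (cong (_+ paraboloid z₂) (sym s₁)) (trans (+-assoc (paraboloid z₀) _ _)
            (cong (paraboloid z₀ +_) (sym s₂))))
    in m+1+n≢m (paraboloid z₀) (trans s₁ (cong paraboloid z₁≡z₀))

  lowerBound : IsCk (suc (suc j)) n c → h * (m ^ r * n ^ j) ≤ c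
  lowerBound (_ , max) = ≤-trans
    (≤-trans (≤-reflexive (sym length-points))
      (length≤size S points-unique λ {p} p∈ → fromWitness {a? = p ∈? points} p∈))
    (max S S-cornerFree)

-- Choice of parameters

n<2^n : ∀ n → n < 2 ^ n
n<2^n zero    = s≤s z≤n
n<2^n (suc n) = subst (suc (suc n) ≤_) (cong (2 ^ n +_) (sym (+-identityʳ (2 ^ n))))
  (+-mono-≤ (≤-trans (s≤s z≤n) (n<2^n n)) (n<2^n n))

-- For n = 2^l the premise says a/b ≤ log n = l when b is positive; exponents of 2 can be compared
-- because powers of 2 increase strictly.
log≤ : ∀ a l b → 2 ^ a ≤ (2 ^ l) ^ b → a ≤ l * b
log≤ a l b le = ≮⇒≥ λ lb<a →
  <⇒≱ (^-monoʳ-< 2 (s≤s (s≤s z≤n)) lb<a) (subst (2 ^ a ≤_) (^-*-assoc 2 l b) le)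

^-distribʳ-* : ∀ e x y → (x * y) ^ e ≡ x ^ e * y ^ e
^-distribʳ-* zero    x y = refl
^-distribʳ-* (suc e) x y =
  trans (cong (x * y *_) (^-distribʳ-* e x y)) (*-interchange x y (x ^ e) (y ^ e))
  where
  *-interchange : ∀ a b c d → a * b * (c * d) ≡ a * c * (b * d)
  *-interchange = solve-∀

-- `R` is the number of digits and also log m; `H` and `L` are log h and log n, with n = 2h. Adding
-- `N` makes n arbitrarily large.
module Parameters (i N : ℕ) where

  K R H L : ℕ
  K = 3 + i
  R = 10 * K + 6 + N
  H = R * R + 4 * R
  L = suc H

  2^R+2^R≡2^1+R : 2 ^ R + 2 ^ R ≡ 2 ^ suc R
  2^R+2^R≡2^1+R = cong (2 ^ R +_) (sym (+-identityʳ (2 ^ R)))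

  -- The low digits need (R + 1)R bits and the leading one at most 3R, which together is `H`.
  digits-fit : (2 ^ R + 2 ^ R) ^ R * suc (R * (2 ^ R * 2 ^ R)) ≤ 2 ^ H
  digits-fit = begin
    (2 ^ R + 2 ^ R) ^ R * suc (R * (2 ^ R * 2 ^ R))  ≡⟨ cong (λ b → b ^ R * suc (R * (2 ^ R * 2 ^ R))) 2^R+2^R≡2^1+R ⟩
    (2 ^ suc R) ^ R * suc (R * (2 ^ R * 2 ^ R))      ≡⟨ cong₂ (λ p q → p * suc (R * q)) (^-*-assoc 2 (suc R) R) (sym (^-distribˡ-+-* 2 R R)) ⟩
    -- Here 1 + RQ ≤ (1 + R)Q ≤ 2^R · Q with Q = 2^(2R).
    2 ^ (suc R * R) * suc (R * 2 ^ (R + R))          ≤⟨ *-monoʳ-≤ (2 ^ (suc R * R)) (+-monoˡ-≤ (R * 2 ^ (R + R)) (m^n>0 2 (R + R))) ⟩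
    2 ^ (suc R * R) * (suc R * 2 ^ (R + R))          ≤⟨ *-monoʳ-≤ (2 ^ (suc R * R)) (*-monoˡ-≤ (2 ^ (R + R)) (n<2^n R)) ⟩
    2 ^ (suc R * R) * (2 ^ R * 2 ^ (R + R))          ≡⟨ cong (2 ^ (suc R * R) *_) (^-distribˡ-+-* 2 R (R + R)) ⟨
    2 ^ (suc R * R) * 2 ^ (R + (R + R))              ≡⟨ ^-distribˡ-+-* 2 (suc R * R) (R + (R + R)) ⟨
    2 ^ (suc R * R + (R + (R + R)))                  ≡⟨ cong (2 ^_) (exponent R) ⟩
    2 ^ H                                            ∎
    where
    open ≤-Reasoning
    exponent : ∀ R → suc R * R + (R + (R + R)) ≡ R * R + 4 * R
    exponent = solve-∀

  c-lowerBound : IsCk K (2 ^ L) c → 2 ^ (H + (R * R + L * suc i)) ≤ c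
  c-lowerBound {c} isCk = subst (_≤ c) eq (lowerBound isCk)
    where
    open CornerFreeSet {R} {2 ^ R} {2 ^ H} {2 ^ L} (suc i) digits-fit
      (≤-reflexive (cong (2 ^ H +_) (sym (+-identityʳ (2 ^ H)))))
    eq : 2 ^ H * ((2 ^ R) ^ R * (2 ^ L) ^ suc i) ≡ 2 ^ (H + (R * R + L * suc i))
    eq = trans (cong (2 ^ H *_)
                 (trans (cong₂ _*_ (^-*-assoc 2 R R) (^-*-assoc 2 L (suc i)))
                   (sym (^-distribˡ-+-* 2 (R * R) (L * suc i)))))
           (sym (^-distribˡ-+-* 2 H (R * R + L * suc i)))

  -- Turns the power of log n into a power of 2. The exponent is linear in `R`, hence small against
  -- log n, which is quadratic.
  L≤2^ : L ≤ 2 ^ ((R + 2) + (R + 2))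
  L≤2^ = begin
    L                          ≤⟨ m≤m+n L 3 ⟩
    L + 3                      ≡⟨ square R ⟩
    (R + 2) * (R + 2)          ≤⟨ *-mono-≤ (<⇒≤ (n<2^n (R + 2))) (<⇒≤ (n<2^n (R + 2))) ⟩
    2 ^ (R + 2) * 2 ^ (R + 2)  ≡⟨ ^-distribˡ-+-* 2 (R + 2) (R + 2) ⟨
    2 ^ ((R + 2) + (R + 2))    ∎
    where
    open ≤-Reasoning
    square : ∀ R → suc (R * R + 4 * R) + 3 ≡ (R + 2) * (R + 2)
    square = solve-∀

  -- The exponent H + R² + L(K - 2) equals LK - (4R + 2). The inequality thus reduces to R² + 4R + 1
  -- ≥ (10K + 6)R + 14K + 6, whence the choice R ≥ 10K + 6.
  exponent≤ : ((R + 2) + (R + 2)) * (3 * K + 1) + L * (K * K + (K ∸ 1))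
              ≤ (H + (R * R + L * suc i)) * suc K
  exponent≤ = m+n≤o⇒m≤o _ (≤-reflexive (identity i N))
    where
    identity : ∀ i N →
      let K = 3 + i
          R = 10 * K + 6 + N
          H = R * R + 4 * R
          L = suc H
      -- The last summand on the left is the exact slack, so a polynomial identity suffices; `2 + i`
      -- is the value of `K ∸ 1`.
      in (((R + 2) + (R + 2)) * (3 * K + 1) + L * (K * K + (2 + i))) + (R * N + 26 * K + 4 * N + 19)
         ≡ (H + (R * R + L * (1 + i))) * suc K
    identity = solve-∀

  N≤2^L : N ≤ 2 ^ L
  N≤2^L = begin
    N      ≤⟨ m≤n+m N (10 * K + 6) ⟩
    R      ≤⟨ m≤m+n R (3 * R) ⟩
    4 * R  ≤⟨ m≤n+m (4 * R) (R * R) ⟩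
    H      ≤⟨ n≤1+n H ⟩
    L      ≤⟨ <⇒≤ (n<2^n L) ⟩
    2 ^ L  ∎
    where open ≤-Reasoning

  Γ-lowerBound : IsCk K (2 ^ L) c → (A : Subset K (2 ^ L)) → size A ≡ 2 * c →
    ∀ a b → 2 ^ a ≤ (2 ^ L) ^ b →
    a ^ (3 * K + 1) * (2 ^ L) ^ (K * K + (K ∸ 1)) ≤ Γ A * c ^ K * b ^ (3 * K + 1)
  Γ-lowerBound {c} isCk A |A|≡2c a b 2^a≤n^b = begin
    a ^ e * (2 ^ L) ^ q              ≤⟨ *-monoˡ-≤ ((2 ^ L) ^ q) (^-monoˡ-≤ e (log≤ a L b 2^a≤n^b)) ⟩
    (L * b) ^ e * (2 ^ L) ^ q        ≡⟨ cong₂ _*_ (^-distribʳ-* e L b) (^-*-assoc 2 L q) ⟩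
    L ^ e * b ^ e * 2 ^ (L * q)      ≡⟨ xyz≡xzy (L ^ e) (b ^ e) (2 ^ (L * q)) ⟩
    L ^ e * 2 ^ (L * q) * b ^ e      ≤⟨ *-monoˡ-≤ (b ^ e) main ⟩
    Γ A * c ^ K * b ^ e              ∎
    where
    open ≤-Reasoning
    e s q E : ℕ
    e = 3 * K + 1
    s = (R + 2) + (R + 2)
    q = K * K + (K ∸ 1)
    E = H + (R * R + L * suc i)
    xyz≡xzy : ∀ x y z → x * y * z ≡ x * z * y
    xyz≡xzy = solve-∀
    c≤Γ : c ≤ Γ A
    -- The constant C' = 2 enters here: of the 2c points at most c survive, which leaves c for
    -- `Γ A`.
    c≤Γ = +-cancelˡ-≤ c _ _ (subst (_≤ c + Γ A)
      (trans |A|≡2c (cong (c +_) (+-identityʳ c))) (size≤c+Γ isCk A))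
    main : L ^ e * 2 ^ (L * q) ≤ Γ A * c ^ K
    main = begin
      L ^ e * 2 ^ (L * q)          ≤⟨ *-monoˡ-≤ (2 ^ (L * q)) (^-monoˡ-≤ e L≤2^) ⟩
      (2 ^ s) ^ e * 2 ^ (L * q)    ≡⟨ cong (_* 2 ^ (L * q)) (^-*-assoc 2 s e) ⟩
      2 ^ (s * e) * 2 ^ (L * q)    ≡⟨ ^-distribˡ-+-* 2 (s * e) (L * q) ⟨
      2 ^ (s * e + L * q)          ≤⟨ ^-monoʳ-≤ 2 exponent≤ ⟩
      2 ^ (E * suc K)              ≡⟨ ^-*-assoc 2 E (suc K) ⟨
      (2 ^ E) ^ suc K              ≤⟨ ^-monoˡ-≤ (suc K) (c-lowerBound isCk) ⟩
      -- One of the K + 1 factors `c` is traded for `Γ A`.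
      c * c ^ K                    ≤⟨ *-monoˡ-≤ (c ^ K) c≤Γ ⟩
      Γ A * c ^ K                  ∎

-- Multiplying by c^k removes the quotient, with (n^k)^k · n^(k-1) = n^(k²+k-1). The real number log
-- n is approached from below by rationals a/b, where a/b ≤ log n reads 2^a ≤ n^b, and b^(3k+1)
-- clears their denominators. The infinite sequence becomes an n above every N.
theorem6 : ∀ (k : ℕ) → 3 ≤ k →
    Σ ℕ λ C' → 1 ≤ C' ×
    (∀ (N : ℕ) → Σ ℕ λ n → N ≤ n × 1 ≤ n ×
    (∀ (c : ℕ) → IsCk k n c →
    ∀ (A : Subset k n) → size A ≡ C' * c →
    ∀ (a b : ℕ) → 1 ≤ b → 2 ^ a ≤ n ^ b →
    a ^ (3 * k + 1) * n ^ (k * k + (k ∸ 1))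
    ≤ Γ A * c ^ k * b ^ (3 * k + 1)))
theorem6 (suc (suc (suc i))) (s≤s (s≤s (s≤s z≤n))) = 2 , s≤s z≤n , λ N →
  let open Parameters i N
  in 2 ^ L , N≤2^L , m^n>0 2 L , λ c isCk A |A|≡2c a b _ 2^a≤n^b →
     Γ-lowerBound isCk A |A|≡2c a b 2^a≤n^b
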